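{- Let $A$ be a finite alphabet, let $\phi\colon A^*\to A^*$ be a non-erasing morphism and let $s\in A$ be such that $\phi$ is prolongable on $s$, and assume that every symbol of $A$ occurs in $\phi^\infty(s)$. Let $I$, $F$, $G$, $L$, $R$ be as defined in the context. Then $\phi^\infty(s)$ is almost periodic if and only if (1) the subgraph of $G$ induced on $I$ is strongly connected, and (2) in each of the graphs $L$ and $R$, every edge lying on a cycle is labeled by the empty word $\Lambda$.
   Context: A morphism $\phi\colon A^*\to A^*$ satisfies $\phi(uv)=\phi(u)\phi(v)$; it is non-erasing if $|\phi(a)|\ge 1$ for every $a\in A$. $\phi$ is prolongable on $s$ if $\phi(s)=su$ with $\phi^n(u)\ne\Lambda$ for all $n$; then $\phi^\infty(s)=\lim_n\phi^n(s)$ is an infinite sequence. A sequence $x$ is almost periodic if for every factor $u$ of $x$ there is $l$ such that every factor of $x$ of length $l$ contains an occurrence of $u$. Let $I$ be the set of $b\in A$ with $|\phi^m(b)|\to\infty$ as $m\to\infty$, and $F=A\setminus I$ (the $b$ with $|\phi^m(b)|$ bounded). $G$ is the directed graph with vertex set $A$ having an edge from $b$ to $c$ iff $c$ occurs in $\phi(b)$. The "graph of left tails" $L$ has vertex set $I$; from each $b\in I$ exactly one edge leaves: write $\phi(b)=ucv$ with $c\in I$ and $u\in F^*$ the maximal prefix of $\phi(b)$ consisting only of symbols from $F$; the edge goes from $b$ to $c$ and is labeled by the word $u$. The "graph of right tails" $R$ is defined analogously using the decomposition $\phi(b)=vcu$ with $c\in I$ and $u\in F^*$ the maximal suffix of $\phi(b)$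 consisting only of symbols of $F$; the edge goes from $b$ to $c$ with label $u$. -}

module Defs where

open import Data.Nat using (ℕ; zero; suc; _+_; _≤_)
open import Data.Fin using (Fin)
open import Data.List using (List; []; _∷_; _++_; length; concatMap)
open import Data.List.Membership.Propositional using (_∈_)
open import Data.List.Relation.Unary.All using (All)
open import Data.Product using (Σ; ∃; _×_; _,_)
open import Data.Unit using (⊤)
open import Relation.Nullary using (¬_)
open import Relation.Binary.PropositionalEquality using (_≡_; _≢_)
open import Relation.Binary.Construct.Closure.ReflexiveTransitive using (Star)

-- The alphabet A is Fin n; words are lists; a morphism A* → A* is
-- determined by its images of letters, φ : Fin n → List (Fin n).

Morphism : ℕ → Set
Morphism n = Fin n → List (Fin n)

ext : ∀ {n} → Morphism n → List (Fin n) → List (Fin n)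
ext φ w = concatMap φ w

iter : ∀ {n} → Morphism n → ℕ → List (Fin n) → List (Fin n)
iter φ zero    w = w
iter φ (suc k) w = ext φ (iter φ k w)

NonErasing : ∀ {n} → Morphism n → Set
NonErasing φ = ∀ a → φ a ≢ []

Prolongable : ∀ {n} → Morphism n → Fin n → Set
Prolongable φ s = Σ (List _) λ u → (φ s ≡ s ∷ u) × (∀ k → iter φ k u ≢ [])

nth : ∀ {a} {A : Set a} → A → List A → ℕ → A
nth d []       _       = d
nth d (x ∷ xs) zero    = x
nth d (x ∷ xs) (suc i) = nth d xs i

-- φ^∞(s) as an infinite sequence ℕ → A: its i-th letter is the i-th letter
-- of φ^(i+1)(s).  When φ is prolongable on s, |φ^(i+1)(s)| ≥ i+2 and each
-- φ^k(s) is a prefix of φ^(k+1)(s), so this is exactly lim φ^k(s)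
-- (the default s is never used).
fixpt : ∀ {n} → Morphism n → Fin n → ℕ → Fin n
fixpt φ s i = nth s (iter φ (suc i) (s ∷ [])) i

OccursAt : ∀ {n} → (ℕ → Fin n) → List (Fin n) → ℕ → Set
OccursAt x []      k = ⊤
OccursAt x (a ∷ u) k = (x k ≡ a) × OccursAt x u (suc k)

IsFactor : ∀ {n} → List (Fin n) → (ℕ → Fin n) → Set
IsFactor u x = ∃ λ i → OccursAt x u i

AlmostPeriodic : ∀ {n} → (ℕ → Fin n) → Set
AlmostPeriodic x =
  ∀ u → IsFactor u x →
  ∃ λ l → ∀ j → ∃ λ k → (j ≤ k) × (k + length u ≤ j + l) × OccursAt x u k

Growing : ∀ {n} → Morphism n → Fin n → Set
Growing φ b = ∀ N → ∃ λ M → ∀ m → M ≤ m → N ≤ length (iter φ m (b ∷ []))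

Bounded : ∀ {n} → Morphism n → Fin n → Set
Bounded φ b = ¬ Growing φ b

GIEdge : ∀ {n} → Morphism n → Fin n → Fin n → Set
GIEdge φ b c = Growing φ b × Growing φ c × (c ∈ φ b)

StronglyConnectedOnI : ∀ {n} → Morphism n → Set
StronglyConnectedOnI φ = ∀ b c → Growing φ b → Growing φ c → Star (GIEdge φ) b c

-- edge of the graph of left tails: b ∈ I, φ(b) = w c v with c ∈ I and
-- w ∈ F* (so w is the maximal F-prefix); labelled by w
LEdge : ∀ {n} → Morphism n → Fin n → Fin n → List (Fin n) → Set
LEdge φ b c w = Growing φ b × Growing φ c × All (Bounded φ) w ×
  (∃ λ v → φ b ≡ w ++ (c ∷ v))

REdge : ∀ {n} → Morphism n → Fin n → Fin n → List (Fin n) → Set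
REdge φ b c w = Growing φ b × Growing φ c × All (Bounded φ) w ×
  (∃ λ v → φ b ≡ v ++ (c ∷ w))

Unlabel : ∀ {n} → (Fin n → Fin n → List (Fin n) → Set) → Fin n → Fin n → Set
Unlabel E b c = ∃ λ w → E b c w

-- every edge lying on a cycle is labelled by the empty word: an edge b → c
-- lies on a cycle iff there is a path (possibly empty) from c back to b
CycleEdgesEmpty : ∀ {n} → (Fin n → Fin n → List (Fin n) → Set) → Set
CycleEdgesEmpty E = ∀ b c w → E b c w → Star (Unlabel E) c b → w ≡ []

{-# OPTIONS --safe #-}
module Submission where

-- Write x = φ^∞(s).  If x is almost periodic, then a letter c occurs in φᵐ(b)
-- for every growing b as soon as φᵐ(b) is long, which gives (1); a non-empty
-- label on a cycle of L or R is pumped by φ into arbitrarily long words over F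
-- in x, whereas s, being growing, occurs in every long factor of x.
-- Conversely, a bounded letter has images of uniformly bounded length, and after
-- n steps every path in L or R runs on a cycle, so by (2) the words over F at
-- the ends of φᵏ(b), b ∈ I, have bounded length.  Desubstituting once bounds all
-- factors of x over F, by some B.  By (1) some power φᴷ maps every growing letter
-- to a word containing a given factor u, and any window of x = φᴷ(x) meeting B + 2
-- blocks contains the image of a growing letter.

open import Defs
open import Data.Nat using (ℕ; zero; suc; _+_; _*_; _∸_; _⊔_; _≤_; _<_; z≤n; s≤s; s≤s⁻¹; _≤?_; _≟_)
open import Data.Nat.Properties hiding (_≟_; _≤?_)
open import Data.Nat.GeneralisedArithmetic using (fold; fold-+)
open import Data.Nat.Induction using (<-rec)
open import Data.Fin using (Fin; zero; suc; toℕ)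
open import Data.Fin.Properties using (pigeonhole; toℕ<n)
open import Data.List using (List; []; _∷_; _++_; length; take; drop)
open import Data.List.Properties
  using (concatMap-++; ++-assoc; ++-identityʳ; length-++; take++drop≡id; length-drop; length-take; ∷-injective)
open import Data.List.Membership.Propositional using (_∈_; find)
open import Data.List.Membership.Propositional.Properties
  using (∈-∃++; ∈-++⁺ˡ; ∈-++⁺ʳ; ∈-++⁻)
open import Data.List.Relation.Unary.Any using (here; there)
open import Data.List.Relation.Unary.All as All using (All; []; _∷_)
open import Data.List.Relation.Unary.All.Properties using (++⁺; ++⁻ˡ; ++⁻ʳ; ¬All⇒Any¬)
open import Data.Product using (∃; ∃₂; _×_; _,_; proj₁; proj₂)
open import Data.Sum using (_⊎_; inj₁; inj₂)
open import Data.Unit using (tt)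
open import Function using (_∘_)
open import Function.Bundles using (_⇔_; mk⇔)
open import Relation.Nullary using (¬_; yes; no; contradiction)
open import Relation.Unary using (Decidable)
open import Relation.Binary.PropositionalEquality
  using (_≡_; _≢_; refl; sym; trans; cong; cong₂; subst; subst₂; module ≡-Reasoning)
open import Relation.Binary.Construct.Closure.ReflexiveTransitive using (Star; ε; _◅_; _◅◅_)

-- Finite words: factorisations, factors and ends of words.

-- Levi's lemma; the two cases say which of the two cuts comes first.
++-split : ∀ {A : Set} (X : List A) {Y} P {Q} → X ++ Y ≡ P ++ Q →
  (∃ λ r → P ≡ X ++ r × Y ≡ r ++ Q) ⊎ (∃ λ r → X ≡ P ++ r × Q ≡ r ++ Y)
++-split []      P       eq = inj₁ (P , refl , eq)
++-split (x ∷ X) []      eq = inj₂ (x ∷ X , refl , sym eq)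
++-split (x ∷ X) (p ∷ P) eq with ∷-injective eq
... | refl , eq′ with ++-split X P eq′
...   | inj₁ (r , refl , e) = inj₁ (r , refl , e)
...   | inj₂ (r , refl , e) = inj₂ (r , refl , e)

Factor : ∀ {A : Set} → List A → List A → Set
Factor w v = ∃₂ λ p q → v ≡ p ++ w ++ q

++-regroup : ∀ {A : Set} (p′ p u : List A) {q q′} →
  p′ ++ (p ++ u ++ q) ++ q′ ≡ (p′ ++ p) ++ u ++ q ++ q′
++-regroup p′ p u {q} {q′} = begin
  p′ ++ (p ++ u ++ q) ++ q′   ≡⟨ cong (p′ ++_) (++-assoc p (u ++ q) q′) ⟩
  p′ ++ p ++ (u ++ q) ++ q′   ≡⟨ cong (λ z → p′ ++ p ++ z) (++-assoc u q q′) ⟩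
  p′ ++ p ++ u ++ q ++ q′     ≡⟨ ++-assoc p′ p _ ⟨
  (p′ ++ p) ++ u ++ q ++ q′   ∎
  where open ≡-Reasoning

Factor-trans : ∀ {A : Set} {u v w : List A} → Factor u v → Factor v w → Factor u w
Factor-trans {u = u} (p , q , refl) (p′ , q′ , refl) = p′ ++ p , q ++ q′ , ++-regroup p′ p u

∈⇒Factor : ∀ {A : Set} {a : A} {w} → a ∈ w → Factor (a ∷ []) w
∈⇒Factor = ∈-∃++

∈-Factor : ∀ {A : Set} {a : A} {u v} → a ∈ u → Factor u v → a ∈ v
∈-Factor a∈u (p , q , refl) = ∈-++⁺ʳ p (∈-++⁺ˡ a∈u)

length-Factor : ∀ {A : Set} {u v : List A} → Factor u v → length u ≤ length v
length-Factor {u = u} (p , q , refl) rewrite length-++ p {u ++ q} | length-++ u {q} =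
  ≤-trans (m≤m+n _ _) (m≤n+m _ (length p))

length≡1 : ∀ {A : Set} (w : List A) → length w ≡ 1 → ∃ λ a → w ≡ a ∷ []
length≡1 (a ∷ []) refl = a , refl

≢[]⇒1≤length : ∀ {A : Set} {w : List A} → w ≢ [] → 1 ≤ length w
≢[]⇒1≤length {w = []}    ne = contradiction refl ne
≢[]⇒1≤length {w = _ ∷ _} ne = s≤s z≤n

data Side : Set where
  left right : Side

-- t lies between c and the end σ of the word, so that Edge left and Edge right
-- below unfold to LEdge and REdge.
place : ∀ {A : Set} → Side → List A → A → List A → List A
place left  t c v = t ++ c ∷ v
place right t c v = v ++ c ∷ t

-- The first argument is the outer one on both sides: `t` is the part that touches the end `σ`.
join : ∀ {A : Set} → Side → List A → List A → List A
join left  t t′ = t ++ t′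
join right t t′ = t′ ++ t

length-join : ∀ {A : Set} σ (t t′ : List A) → length (join σ t t′) ≡ length t + length t′
length-join left  t t′ = length-++ t
length-join right t t′ = trans (length-++ t′) (+-comm (length t′) (length t))

All-join : ∀ {A : Set} {P : A → Set} σ {t t′} → All P t → All P t′ → All P (join σ t t′)
All-join left  a b = ++⁺ a b
All-join right a b = ++⁺ b a

place-Factor : ∀ {A : Set} σ (t : List A) c v → Factor t (place σ t c v)
place-Factor left  t c v = [] , c ∷ v , refl
place-Factor right t c v = v ++ c ∷ [] , [] ,
  trans (cong (λ z → v ++ c ∷ z) (sym (++-identityʳ t))) (sym (++-assoc v (c ∷ []) _))

nearest : ∀ {A : Set} {P : A → Set} → Decidable P → ∀ σ w →
  (∃ λ t → ∃₂ λ c v → w ≡ place σ t c v × P c × All (¬_ ∘ P) t) ⊎ All (¬_ ∘ P) w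
nearest P? σ [] = inj₂ []
nearest P? left (a ∷ w) with P? a | nearest P? left w
... | yes p | _ = inj₁ ([] , a , w , refl , p , [])
... | no ¬p | inj₁ (t , c , v , refl , pc , all) = inj₁ (a ∷ t , c , v , refl , pc , ¬p ∷ all)
... | no ¬p | inj₂ all = inj₂ (¬p ∷ all)
-- From the right end, a hit further on in `w` takes precedence over `a`, so the recursive result is
-- inspected first.
nearest P? right (a ∷ w) with P? a | nearest P? right w
... | _     | inj₁ (t , c , v , refl , pc , all) = inj₁ (t , c , a ∷ v , refl , pc , all)
... | yes p | inj₂ all = inj₁ (w , a , [] , refl , p , all)
... | no ¬p | inj₂ all = inj₂ (¬p ∷ all)

sup : ∀ {n} (f : Fin n → ℕ) → ∃ λ C → ∀ a → f a ≤ C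
sup {zero}  f = 0 , λ ()
sup {suc n} f with sup (f ∘ suc)
... | C , h = f zero ⊔ C , λ { zero → m≤m⊔n _ _ ; (suc a) → ≤-trans (h a) (m≤n⊔m (f zero) C) }

-- If `w` reached beyond `t`, it would contain `c`, which fails `P`. Used with `P` the bounded
-- letters and `c` a growing one, it confines a bounded prefix to the left tail.
before-first : ∀ {A : Set} {P : A → Set} t {c r} w {q} →
  t ++ c ∷ r ≡ w ++ q → ¬ P c → All P w → length w ≤ length t
before-first t w eq ¬pc pw with ++-split t w eq
... | inj₁ ([]    , refl , _)    = ≤-reflexive (cong length (++-identityʳ t))
... | inj₁ (_ ∷ _ , refl , refl) = contradiction (All.head (++⁻ʳ t pw)) ¬pc
... | inj₂ (z , refl , _)        = subst (length w ≤_) (sym (length-++ w)) (m≤m+n _ _)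

after-last : ∀ {A : Set} {P : A → Set} v {c t} p {r} →
  v ++ c ∷ t ≡ p ++ r → ¬ P c → All P r → length r ≤ length t
after-last v p eq ¬pc pr with ++-split v p eq
... | inj₁ ([]    , _ , refl) = contradiction (All.head pr) ¬pc
... | inj₁ (_ ∷ z , _ , refl) = subst (_ ≤_) (sym (length-++ z)) (m≤n+m _ (length z))
... | inj₂ (z , _ , refl)     = contradiction (All.head (++⁻ʳ z pr)) ¬pc

place-single : ∀ {A : Set} σ (a : A) → a ∷ [] ≡ place σ [] a []
place-single left  a = refl
place-single right a = refl

-- Occurrences of words in an infinite sequence.

module _ {n : ℕ} (x : ℕ → Fin n) where

  occurs-++⁻ʳ : ∀ u {v i} → OccursAt x (u ++ v) i → OccursAt x v (length u + i)
  occurs-++⁻ʳ []      o = o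
  occurs-++⁻ʳ (a ∷ u) {v} {i} (_ , o) = subst (OccursAt x v) (+-suc (length u) i) (occurs-++⁻ʳ u o)

  occurs-++⁻ˡ : ∀ u {v i} → OccursAt x (u ++ v) i → OccursAt x u i
  occurs-++⁻ˡ []      o       = tt
  occurs-++⁻ˡ (a ∷ u) (e , o) = e , occurs-++⁻ˡ u o

  occurs-∈ : ∀ w {j k} → OccursAt x w j → j ≤ k → k < j + length w → x k ∈ w
  occurs-∈ [] {j} {k} o j≤k k< = contradiction (≤-trans k< (subst (_≤ k) (sym (+-identityʳ j)) j≤k)) (<-irrefl refl)
  occurs-∈ (a ∷ w) {j} {k} (e , o) j≤k k< with j ≟ k
  ... | yes refl = here e
  ... | no j≢k   = there (occurs-∈ w o (≤∧≢⇒< j≤k j≢k) (subst (k <_) (+-suc j (length w)) k<))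

  occurs-prefix : ∀ w v {i} → OccursAt x w i → OccursAt x v i → length w ≤ length v → ∃ λ q → v ≡ w ++ q
  occurs-prefix [] v _ _ _ = v , refl
  occurs-prefix (a ∷ w) (b ∷ v) (refl , o) (refl , o′) (s≤s le) with occurs-prefix w v o o′ le
  ... | q , refl = q , refl

  occurs-pointwise : ∀ {d} w {j} → (∀ i → i < length w → x (i + j) ≡ nth d w i) → OccursAt x w j
  occurs-pointwise [] h = tt
  occurs-pointwise (a ∷ w) {j} h = h 0 (s≤s z≤n) , occurs-pointwise w λ i i< →
    trans (cong x (+-suc i j)) (h (suc i) (s≤s i<))

  occurs⇒Factor : ∀ w v {i} → OccursAt x w i → OccursAt x v 0 → i + length w ≤ length v → Factor w v
  occurs⇒Factor w v {i} ow ov le = take i v , proj₁ rest ,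
    trans (sym (take++drop≡id i v)) (cong (take i v ++_) (proj₂ rest))
    where
    i≤v : i ≤ length v
    i≤v = ≤-trans (m≤m+n i _) le
    at-i : length (take i v) + 0 ≡ i
    at-i = trans (+-identityʳ _) (trans (length-take i v) (m≤n⇒m⊓n≡m i≤v))
    rest : ∃ λ q → drop i v ≡ w ++ q
    rest = occurs-prefix w (drop i v) ow
      (subst (OccursAt x (drop i v)) at-i
        (occurs-++⁻ʳ (take i v) (subst (λ z → OccursAt x z 0) (sym (take++drop≡id i v)) ov)))
      (subst (length w ≤_) (sym (length-drop i v)) (subst (_≤ length v ∸ i) (m+n∸m≡n i (length w)) (∸-monoˡ-≤ i le)))

nth-++ˡ : ∀ {A : Set} {d : A} w {v i} → i < length w → nth d (w ++ v) i ≡ nth d w i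
nth-++ˡ (a ∷ w) {i = zero}  _        = refl
nth-++ˡ (a ∷ w) {i = suc i} (s≤s lt) = nth-++ˡ w lt

-- Orbits of a self-map of a finite set.

module _ {n : ℕ} (h : Fin n → Fin n) where

  fold-∸ : ∀ b {i k} → i ≤ k → fold b h k ≡ fold (fold b h i) h (k ∸ i)
  fold-∸ b {i} {k} i≤k = trans (cong (fold b h) (sym (m∸n+n≡m i≤k))) (fold-+ b h (k ∸ i))

  fold-suc : ∀ b k → fold b h (suc k) ≡ fold (h b) h k
  fold-suc b k = trans (cong (fold b h) (+-comm 1 k)) (fold-+ b h k)

  -- Two of the first `n + 1` orbit points coincide, so from index `n` on the orbit runs on a cycle.
  -- The return starts at the successor of the point because `CycleEdgesEmpty` asks for a path from
  -- the target of an edge back to its source.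
  eventually-periodic : ∀ b k → n ≤ k → ∃ λ p → fold (h (fold b h k)) h p ≡ fold b h k
  eventually-periodic b k n≤k with pigeonhole (n<1+n n) (λ i → fold b h (toℕ i))
  ... | i , j , i<j , eq = p , (begin
    fold (h (fold b h k)) h p                      ≡⟨ fold-suc (fold b h k) p ⟨
    fold (fold b h k) h (suc p)                    ≡⟨ fold-+ b h (suc p) ⟨
    fold b h (suc p + k)                           ≡⟨ fold-∸ b j≤ ⟩
    fold (fold b h (toℕ j)) h (suc p + k ∸ toℕ j)  ≡⟨ cong₂ (λ c m → fold c h m) (sym eq) arith ⟩
    fold (fold b h (toℕ i)) h (k ∸ toℕ i)          ≡⟨ fold-∸ b i≤k ⟨
    fold b h k                                     ∎)
    where
    open ≡-Reasoning
    -- One less than the period `j - i`, since one step is already spent on reaching the successor.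
    p = toℕ j ∸ suc (toℕ i)
    sp : suc p ≡ toℕ j ∸ toℕ i
    sp = sym (+-∸-assoc 1 i<j)
    i≤k : toℕ i ≤ k
    i≤k = ≤-trans (<⇒≤ i<j) (≤-trans (s≤s⁻¹ (toℕ<n j)) n≤k)
    j≡ : suc p + toℕ i ≡ toℕ j
    j≡ = trans (cong (_+ toℕ i) sp) (m∸n+n≡m (<⇒≤ i<j))
    j≤ : toℕ j ≤ suc p + k
    j≤ = subst (_≤ suc p + k) j≡ (+-monoʳ-≤ (suc p) i≤k)
    arith : suc p + k ∸ toℕ j ≡ k ∸ toℕ i
    arith = trans (cong (suc p + k ∸_) (sym j≡)) ([m+n]∸[m+o]≡n∸o (suc p) k (toℕ i))

-- Iterates of a morphism.

module Morphisms {n : ℕ} (φ : Morphism n) where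

  Word : Set
  Word = List (Fin n)

  img : ℕ → Fin n → Word
  img k a = iter φ k (a ∷ [])

  iter-++ : ∀ k u {v} → iter φ k (u ++ v) ≡ iter φ k u ++ iter φ k v
  iter-++ zero    u = refl
  iter-++ (suc k) u = trans (cong (ext φ) (iter-++ k u)) (concatMap-++ φ (iter φ k u) _)

  iter-[] : ∀ k → iter φ k [] ≡ []
  iter-[] zero = refl
  iter-[] (suc k) = cong (ext φ) (iter-[] k)

  iter-+ : ∀ k m w → iter φ (k + m) w ≡ iter φ k (iter φ m w)
  iter-+ zero    m w = refl
  iter-+ (suc k) m w = cong (ext φ) (iter-+ k m w)

  iter-suc : ∀ k w → iter φ (suc k) w ≡ iter φ k (ext φ w)
  iter-suc zero    w = refl
  iter-suc (suc k) w = cong (ext φ) (iter-suc k w)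

  img-suc : ∀ k a → img (suc k) a ≡ iter φ k (φ a)
  img-suc k a = trans (iter-suc k (a ∷ [])) (cong (iter φ k) (++-identityʳ (φ a)))

  iter-Factor : ∀ k {u v} → Factor u v → Factor (iter φ k u) (iter φ k v)
  iter-Factor k {u} (p , q , refl) = iter φ k p , iter φ k q ,
    trans (iter-++ k p) (cong (iter φ k p ++_) (iter-++ k u))

  ∈-iter : ∀ k {a c w} → a ∈ w → c ∈ img k a → c ∈ iter φ k w
  ∈-iter k a∈w c∈ = ∈-Factor c∈ (iter-Factor k (∈⇒Factor a∈w))

  ∈-iter⁻ : ∀ k {c} w → c ∈ iter φ k w → ∃ λ a → a ∈ w × c ∈ img k a
  ∈-iter⁻ k [] c∈ with iter φ k [] | iter-[] k
  ∈-iter⁻ k [] () | _ | refl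
  ∈-iter⁻ k (a ∷ w) c∈ with ∈-++⁻ (img k a) (subst (_ ∈_) (iter-++ k (a ∷ [])) c∈)
  ... | inj₁ c∈a = a , here refl , c∈a
  ... | inj₂ c∈w with ∈-iter⁻ k w c∈w
  ...   | b , b∈w , c∈b = b , there b∈w , c∈b

  ∈-img-suc : ∀ k {a b c} → b ∈ φ a → c ∈ img k b → c ∈ img (suc k) a
  ∈-img-suc k {a} b∈ c∈ = subst (_ ∈_) (sym (img-suc k a)) (∈-iter k b∈ c∈)

  ∈-img-suc⁻ : ∀ k {a c} → c ∈ img (suc k) a → ∃ λ b → b ∈ φ a × c ∈ img k b
  ∈-img-suc⁻ k {a} c∈ = ∈-iter⁻ k (φ a) (subst (_ ∈_) (img-suc k a) c∈)

  -- The composition law for tails: the image of the old tail stays outermost, and the tail of the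
  -- image of `c` follows it inwards.
  iter-place : ∀ k σ t c v {t′ d v′} → img k c ≡ place σ t′ d v′ →
    ∃ λ v″ → iter φ k (place σ t c v) ≡ place σ (join σ (iter φ k t) t′) d v″
  iter-place k left t c v {t′} {d} {v′} eq = v′ ++ iter φ k v , (begin
    iter φ k (t ++ c ∷ v)                       ≡⟨ iter-++ k t ⟩
    iter φ k t ++ iter φ k (c ∷ v)              ≡⟨ cong (iter φ k t ++_) (iter-++ k (c ∷ [])) ⟩
    iter φ k t ++ img k c ++ iter φ k v         ≡⟨ cong (λ z → iter φ k t ++ z ++ iter φ k v) eq ⟩
    iter φ k t ++ (t′ ++ d ∷ v′) ++ iter φ k v  ≡⟨ cong (iter φ k t ++_) (++-assoc t′ (d ∷ v′) _) ⟩
    iter φ k t ++ t′ ++ d ∷ v′ ++ iter φ k v    ≡⟨ ++-assoc (iter φ k t) t′ _ ⟨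
    (iter φ k t ++ t′) ++ d ∷ v′ ++ iter φ k v  ∎)
    where open ≡-Reasoning
  iter-place k right t c v {t′} {d} {v′} eq = iter φ k v ++ v′ , (begin
    iter φ k (v ++ c ∷ t)                       ≡⟨ iter-++ k v ⟩
    iter φ k v ++ iter φ k (c ∷ t)              ≡⟨ cong (iter φ k v ++_) (iter-++ k (c ∷ [])) ⟩
    iter φ k v ++ img k c ++ iter φ k t         ≡⟨ cong (λ z → iter φ k v ++ z ++ iter φ k t) eq ⟩
    iter φ k v ++ (v′ ++ d ∷ t′) ++ iter φ k t  ≡⟨ cong (iter φ k v ++_) (++-assoc v′ (d ∷ t′) _) ⟩
    iter φ k v ++ v′ ++ d ∷ t′ ++ iter φ k t    ≡⟨ ++-assoc (iter φ k v) v′ _ ⟨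
    (iter φ k v ++ v′) ++ d ∷ t′ ++ iter φ k t  ∎)
    where open ≡-Reasoning

  length-iter-≤ : ∀ k {M} w → (∀ {a} → a ∈ w → length (img k a) ≤ M) →
    length (iter φ k w) ≤ length w * M
  length-iter-≤ k [] h rewrite iter-[] k = z≤n
  length-iter-≤ k (a ∷ w) h rewrite iter-++ k (a ∷ []) {w} | length-++ (img k a) {iter φ k w} =
    +-mono-≤ (h (here refl)) (length-iter-≤ k w (h ∘ there))

  Edge : Side → Fin n → Fin n → Word → Set
  Edge σ b c w = Growing φ b × Growing φ c × All (Bounded φ) w ×
    (∃ λ v → φ b ≡ place σ w c v)

  -- Growing and bounded letters of a non-erasing morphism.

  module _ (ne : NonErasing φ) where

    ext-length : ∀ w → length w ≤ length (ext φ w)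
    ext-length [] = z≤n
    ext-length (a ∷ w) with φ a in eq
    ... | []    = contradiction eq (ne a)
    ... | b ∷ t = s≤s (≤-trans (ext-length w) (subst (length (ext φ w) ≤_) (sym (length-++ t)) (m≤n+m _ (length t))))

    iter-length : ∀ k w → length w ≤ length (iter φ k w)
    iter-length zero w = ≤-refl
    iter-length (suc k) w = ≤-trans (iter-length k w) (ext-length (iter φ k w))

    img-mono : ∀ {k m} a → k ≤ m → length (img k a) ≤ length (img m a)
    img-mono {k} {m} a k≤m = subst (λ z → length (img k a) ≤ length (img z a)) (m∸n+n≡m k≤m)
      (subst (λ z → length (img k a) ≤ length z) (sym (iter-+ (m ∸ k) k _)) (iter-length (m ∸ k) _))

    growing-from : ∀ {b} → (∀ N → ∃ λ M → N ≤ length (img M b)) → Growing φ b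
    growing-from {b} h N with h N
    ... | M , N≤ = M , λ m M≤m → ≤-trans N≤ (img-mono b M≤m)

    growing-back : ∀ k {b c} → c ∈ img k b → Growing φ c → Growing φ b
    growing-back k {b} {c} c∈ g = growing-from λ N → let M , h = g N in
      M + k , ≤-trans (h M ≤-refl)
        (subst (λ z → length (img M c) ≤ length z) (sym (iter-+ M k _))
          (length-Factor (iter-Factor M (∈⇒Factor c∈))))

    growing-pred : ∀ {b c} → c ∈ φ b → Growing φ c → Growing φ b
    growing-pred c∈ = growing-back 1 (∈-img-suc 0 c∈ (here refl))

    bounded-iter : ∀ k {w} → All (Bounded φ) w → All (Bounded φ) (iter φ k w)
    bounded-iter k {w} bw = All.tabulate λ {c} c∈ gc → let a , a∈w , c∈a = ∈-iter⁻ k w c∈ in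
      All.lookup bw a∈w (growing-back k c∈a gc)

    -- The ancestors of one occurrence of `d`, generation by generation. They are listed by a
    -- function so that the pigeonhole principle can be applied to them.
    path : ∀ k {b d} → d ∈ img k b → ∃ λ (f : ℕ → Fin n) →
      f 0 ≡ b × f k ≡ d × (∀ i → i < k → f (suc i) ∈ φ (f i))
    path zero {b} (here refl) = (λ _ → b) , refl , refl , λ _ ()
    path (suc k) {b} d∈ with ∈-img-suc⁻ k d∈
    ... | e , e∈b , d∈e with path k d∈e
    ...   | f , refl , fk , step = f′ , refl , fk , step′
      where
      f′ : ℕ → Fin n
      f′ zero    = b
      f′ (suc i) = f i
      step′ : ∀ i → i < suc k → f′ (suc i) ∈ φ (f′ i)
      step′ zero    _         = e∈b
      step′ (suc i) (s≤s i<k) = step i i<k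

    segment : ∀ {k} {f : ℕ → Fin n} → (∀ i → i < k → f (suc i) ∈ φ (f i)) →
      ∀ m i → m + i ≤ k → f (m + i) ∈ img m (f i)
    segment step zero    i _ = here refl
    segment {k} {f} step (suc m) i le = ∈-img-suc m
      (step i (≤-trans (s≤s (m≤n+m i m)) le))
      (subst (λ z → f z ∈ img m (f (suc i))) (+-suc m i)
        (segment step m (suc i) (subst (_≤ k) (sym (+-suc m i)) le)))

    -- Each further `p` steps reproduce `c` together with at least one other letter, and the images
    -- of the other letters never vanish; so the length grows at least linearly.
    duplicating : ∀ {p c} → c ∈ img p c → 2 ≤ length (img p c) →
      ∀ k → suc k ≤ length (img (k * p) c)
    duplicating c∈ 2≤ zero = ≤-refl
    duplicating {p} {c} c∈ 2≤ (suc k) with ∈-∃++ c∈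
    ... | u , v , eq = begin
      2 + k                                                ≤⟨ s≤s (duplicating c∈ 2≤ k) ⟩
      1 + L                                                ≤⟨ +-monoˡ-≤ L uv ⟩
      length u + length v + L                              ≡⟨ +-assoc (length u) _ _ ⟩
      length u + (length v + L)                            ≡⟨ cong (length u +_) (+-comm (length v) L) ⟩
      length u + (L + length v)
        ≤⟨ +-mono-≤ (iter-length (k * p) u) (+-monoʳ-≤ L (iter-length (k * p) v)) ⟩
      length (iter φ (k * p) u) + (L + length (iter φ (k * p) v))  ≡⟨ split ⟨
      length (img (p + k * p) c)                           ∎
      where
      open ≤-Reasoning
      L = length (img (k * p) c)
      uv : 1 ≤ length u + length v
      uv = s≤s⁻¹ (subst (2 ≤_) (trans (cong length eq) (trans (length-++ u) (+-suc (length u) (length v)))) 2≤)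
      split : length (img (p + k * p) c) ≡
        length (iter φ (k * p) u) + (L + length (iter φ (k * p) v))
      split = begin-equality
        length (img (p + k * p) c)               ≡⟨ cong (λ z → length (img z c)) (+-comm p (k * p)) ⟩
        length (img (k * p + p) c)               ≡⟨ cong length (iter-+ (k * p) p _) ⟩
        length (iter φ (k * p) (img p c))        ≡⟨ cong (length ∘ iter φ (k * p)) eq ⟩
        length (iter φ (k * p) (u ++ c ∷ v))     ≡⟨ cong length (iter-++ (k * p) u) ⟩
        length (iter φ (k * p) u ++ iter φ (k * p) (c ∷ v))  ≡⟨ length-++ (iter φ (k * p) u) ⟩
        length (iter φ (k * p) u) + length (iter φ (k * p) (c ∷ v))
          ≡⟨ cong (λ z → length (iter φ (k * p) u) + length z) (iter-++ (k * p) (c ∷ [])) ⟩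
        length (iter φ (k * p) u) + length (img (k * p) c ++ iter φ (k * p) v)
          ≡⟨ cong (length (iter φ (k * p) u) +_) (length-++ (img (k * p) c)) ⟩
        length (iter φ (k * p) u) + (L + length (iter φ (k * p) v)) ∎

    fixed-power : ∀ {p c} → img p c ≡ c ∷ [] → ∀ k → img (k * p) c ≡ c ∷ []
    fixed-power eq zero = refl
    fixed-power {p} eq (suc k) =
      trans (iter-+ p (k * p) _) (trans (cong (iter φ p) (fixed-power {p} eq k)) eq)

    -- Either `c` returns in company, and `duplicating` applies, or it returns alone. In the latter
    -- case its images have length 1 at all multiples of the period, hence at all times by
    -- monotonicity, and `c` could not lead to a `d` with a longer image.
    recurrent-growing : ∀ {p q c d} → c ∈ img (suc p) c → d ∈ img q c →
      2 ≤ length (img n d) → Growing φ c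
    recurrent-growing {p} {q} {c} {d} c∈ d∈ 2≤ with 2 ≤? length (img (suc p) c)
    ... | yes 2≤p = growing-from λ N → N * suc p , ≤-trans (n≤1+n N) (duplicating c∈ 2≤p N)
    ... | no ¬2≤p = contradiction (begin
      2                              ≤⟨ 2≤ ⟩
      length (img n d)               ≤⟨ length-Factor (iter-Factor n (∈⇒Factor d∈)) ⟩
      length (iter φ n (img q c))    ≡⟨ cong length (iter-+ n q _) ⟨
      -- A multiple of the positive period that is at least `n + q`.
      length (img (n + q) c)         ≤⟨ img-mono c (m≤m*n (n + q) (suc p)) ⟩
      length (img ((n + q) * suc p) c)  ≡⟨ cong length (fixed-power {suc p} fix (n + q)) ⟩
      1                              ∎) (<-irrefl refl)
      where
      open ≤-Reasoning
      fix : img (suc p) c ≡ c ∷ []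
      fix with length≡1 _ (≤-antisym (s≤s⁻¹ (≰⇒> ¬2≤p)) (iter-length (suc p) (c ∷ [])))
      ... | e , eq with subst (c ∈_) eq c∈
      ...   | here refl = eq

    -- The images at steps `0` to `n` are single letters by monotonicity, and two of them coincide;
    -- a later step can therefore be traded for an earlier one. Consequently, once all letters of
    -- `φⁿ(b)` are thin, the length of the images of `b` stays constant.
    thin-forever : ∀ {a} → length (img n a) ≡ 1 → ∀ k → length (img k a) ≡ 1
    thin-forever {a} thin = <-rec _ go
      where
      short : ∀ k → k ≤ n → length (img k a) ≡ 1
      short k k≤n = ≤-antisym (subst (length (img k a) ≤_) thin (img-mono a k≤n)) (iter-length k (a ∷ []))
      single : (i : Fin (suc n)) → ∃ λ c → img (toℕ i) a ≡ c ∷ []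
      single i = length≡1 _ (short (toℕ i) (s≤s⁻¹ (toℕ<n i)))
      go : ∀ m → (∀ {r} → r < m → length (img r a) ≡ 1) → length (img m a) ≡ 1
      go m rec with m ≤? n | pigeonhole (n<1+n n) (proj₁ ∘ single)
      ... | yes m≤n | _ = short m m≤n
      ... | no m≰n | i , j , i<j , eq = trans (cong length back) (rec smaller)
        where
        j≤m : toℕ j ≤ m
        j≤m = ≤-trans (s≤s⁻¹ (toℕ<n j)) (<⇒≤ (≰⇒> m≰n))
        back : img m a ≡ img (m ∸ toℕ j + toℕ i) a
        back = begin
          img m a                              ≡⟨ cong (λ z → img z a) (m∸n+n≡m j≤m) ⟨
          img (m ∸ toℕ j + toℕ j) a            ≡⟨ iter-+ (m ∸ toℕ j) (toℕ j) _ ⟩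
          iter φ (m ∸ toℕ j) (img (toℕ j) a)   ≡⟨ cong (iter φ (m ∸ toℕ j)) (proj₂ (single j)) ⟩
          iter φ (m ∸ toℕ j) (_ ∷ [])          ≡⟨ cong (λ z → iter φ (m ∸ toℕ j) (z ∷ [])) eq ⟨
          iter φ (m ∸ toℕ j) (_ ∷ [])          ≡⟨ cong (iter φ (m ∸ toℕ j)) (proj₂ (single i)) ⟨
          iter φ (m ∸ toℕ j) (img (toℕ i) a)   ≡⟨ iter-+ (m ∸ toℕ j) (toℕ i) _ ⟨
          img (m ∸ toℕ j + toℕ i) a            ∎
          where open ≡-Reasoning
        smaller : m ∸ toℕ j + toℕ i < m
        smaller = subst (m ∸ toℕ j + toℕ i <_) (m∸n+n≡m j≤m) (+-monoʳ-< (m ∸ toℕ j) i<j)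

    -- A path of length n from b to a letter that is not permanently thin
    -- passes twice through some letter, and that letter is growing.
    growing-or-stable : ∀ b → Growing φ b ⊎ (∀ k → length (img k b) ≤ length (img n b))
    growing-or-stable b with All.all? (λ a → length (img n a) ≟ 1) (img n b)
    ... | yes thin = inj₂ λ k → begin
      length (img k b)              ≤⟨ img-mono b (m≤m+n k n) ⟩
      length (img (k + n) b)        ≡⟨ cong length (iter-+ k n _) ⟩
      length (iter φ k (img n b))
        ≤⟨ length-iter-≤ k (img n b) (λ a∈ → ≤-reflexive (thin-forever (All.lookup thin a∈) k)) ⟩
      length (img n b) * 1          ≡⟨ *-identityʳ _ ⟩
      length (img n b)              ∎
      where open ≤-Reasoning
    ... | no ¬thin with find (¬All⇒Any¬ (λ a → length (img n a) ≟ 1) _ ¬thin)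
    ...   | d , d∈ , d≢1 with path n d∈
    ...     | f , refl , refl , step with pigeonhole (n<1+n n) (f ∘ toℕ)
    ...       | i , j , i<j , eq = inj₁ (growing-back (toℕ i)
      (subst (λ z → f z ∈ img (toℕ i) (f 0)) (+-identityʳ (toℕ i))
        (segment step (toℕ i) 0 (subst (_≤ n) (sym (+-identityʳ (toℕ i))) i≤n)))
      (recurrent-growing {p = toℕ j ∸ suc (toℕ i)} {q = n ∸ toℕ i}
        (subst₂ (λ m c → c ∈ img m (f (toℕ i))) (+-∸-assoc 1 i<j) (sym eq) (between i≤j j≤n))
        (between i≤n ≤-refl)
        (≤∧≢⇒< (iter-length n _) (d≢1 ∘ sym))))
      where
      j≤n = s≤s⁻¹ (toℕ<n j)
      i≤j = <⇒≤ i<j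
      i≤n = ≤-trans i≤j j≤n
      between : ∀ {k m} → k ≤ m → m ≤ n → f m ∈ img (m ∸ k) (f k)
      between {k} {m} k≤m m≤n = subst (λ z → f z ∈ img (m ∸ k) (f k)) (m∸n+n≡m k≤m)
        (segment step (m ∸ k) k (subst (_≤ n) (sym (m∸n+n≡m k≤m)) m≤n))

    growing? : Decidable (Growing φ)
    growing? b with growing-or-stable b
    ... | inj₁ g = yes g
    ... | inj₂ stable = no λ g → let M , h = g (suc (length (img n b))) in
      <-irrefl refl (≤-trans (h M ≤-refl) (stable M))

    -- By `growing-or-stable` the images of a bounded letter are longest at step `n`, so a maximum
    -- taken at this single step bounds them for all `k`.
    maxBounded : ℕ
    maxBounded = proj₁ (sup (λ a → length (img n a)))

    bounded-img : ∀ {a} → Bounded φ a → ∀ k → length (img k a) ≤ maxBounded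
    bounded-img {a} ba k with growing-or-stable a
    ... | inj₁ g      = contradiction g ba
    ... | inj₂ stable = ≤-trans (stable k) (proj₂ (sup (λ a → length (img n a))) a)

    bounded-iter-length : ∀ k {w} → All (Bounded φ) w → length (iter φ k w) ≤ length w * maxBounded
    bounded-iter-length k {w} bw = length-iter-≤ k w λ a∈ → bounded-img (All.lookup bw a∈) k

    -- If `φ b` consisted of bounded letters only, all images of `b` would have length bounded in
    -- terms of `φ b`, against growth.
    nearest-edge : ∀ σ {b} → Growing φ b → ∃₂ λ c t → Edge σ b c t
    nearest-edge σ {b} g with nearest growing? σ (φ b)
    ... | inj₁ (t , c , v , eq , gc , bt) = c , t , g , gc , bt , v , eq
    ... | inj₂ bφ = let M , h = g (suc (length (φ b) * maxBounded)) in
      contradiction (begin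
        suc (length (φ b) * maxBounded)  ≤⟨ h (suc M) (n≤1+n M) ⟩
        length (img (suc M) b)           ≡⟨ cong length (img-suc M b) ⟩
        length (iter φ M (φ b))          ≤⟨ bounded-iter-length M bφ ⟩
        length (φ b) * maxBounded        ∎) (<-irrefl refl)
      where open ≤-Reasoning

    -- Walks in the graph of tails at the end `σ`.

    module Tails (σ : Side) where

      -- Totalised, with dummy values at bounded letters, so that `next` is a self-map of the whole
      -- alphabet whose orbits are eventually periodic.
      nearest-edge′ : ∀ b → ∃₂ λ c t → All (Bounded φ) t × (Growing φ b → Edge σ b c t)
      nearest-edge′ b with growing? b
      ... | no ¬g = b , [] , [] , λ g → contradiction g ¬g
      ... | yes g with nearest-edge σ g
      ...   | c , t , e@(_ , _ , bt , _) = c , t , bt , λ _ → e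

      next : Fin n → Fin n
      next b = proj₁ (nearest-edge′ b)

      tail : Fin n → Word
      tail b = proj₁ (proj₂ (nearest-edge′ b))

      tail-bounded : ∀ b → All (Bounded φ) (tail b)
      tail-bounded b = proj₁ (proj₂ (proj₂ (nearest-edge′ b)))

      edge : ∀ {b} → Growing φ b → Edge σ b (next b) (tail b)
      edge {b} = proj₂ (proj₂ (proj₂ (nearest-edge′ b)))

      next-growing : ∀ {b} → Growing φ b → Growing φ (next b)
      next-growing g = proj₁ (proj₂ (edge g))

      orbit-growing : ∀ {b} k → Growing φ b → Growing φ (fold b next k)
      orbit-growing zero    g = g
      orbit-growing (suc k) g = next-growing (orbit-growing k g)

      orbit-path : ∀ {b} k → Growing φ b → Star (Unlabel (Edge σ)) b (fold b next k)
      orbit-path zero    g = ε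
      orbit-path (suc k) g = orbit-path k g ◅◅ ((_ , edge (orbit-growing k g)) ◅ ε)

      -- Bounds the length of the bounded word between the end σ of φᵏ(b) and
      -- the growing letter nearest to that end.
      cost : ℕ → Fin n → ℕ
      cost zero    b = 0
      cost (suc k) b = length (tail b) * maxBounded + cost k (next b)

      -- The definition peels off the first edge of the walk; this form peels off the last, which
      -- lies on a cycle once the walk is long.
      cost-suc : ∀ k b → cost (suc k) b ≡ cost k b + length (tail (fold b next k)) * maxBounded
      cost-suc zero    b = +-identityʳ _
      cost-suc (suc k) b = begin
        T + cost (suc k) (next b)                                              ≡⟨ cong (T +_) (cost-suc k (next b)) ⟩
        T + (cost k (next b) + length (tail (fold (next b) next k)) * maxBounded) ≡⟨ +-assoc T _ _ ⟨
        T + cost k (next b) + length (tail (fold (next b) next k)) * maxBounded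
          ≡⟨ cong (λ z → T + cost k (next b) + length (tail z) * maxBounded) (fold-suc next b k) ⟨
        T + cost k (next b) + length (tail (fold b next (suc k))) * maxBounded ∎
        where
        open ≡-Reasoning
        T = length (tail b) * maxBounded

      cost-+ : ∀ k m b → cost k b ≤ cost (k + m) b
      cost-+ zero    m b = z≤n
      cost-+ (suc k) m b = +-monoʳ-≤ (length (tail b) * maxBounded) (cost-+ k m (next b))

      -- The edge at `b` contributes `φᵏ` of its label, whose length is at most `maxBounded` times
      -- that of the label whatever `k` is; `iter-place` sets it outside the tail of the image of
      -- `next b`.
      img-end : ∀ k {b} → Growing φ b → ∃ λ t → ∃₂ λ c v → img k b ≡ place σ t c v ×
        Growing φ c × All (Bounded φ) t × length t ≤ cost k b
      img-end zero {b} g = [] , b , [] , place-single σ b , g , [] , z≤n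
      img-end (suc k) {b} g with edge g | img-end k (next-growing g)
      ... | _ , _ , _ , v , eq | t , c , _ , eq′ , gc , bt , le with iter-place k σ (tail b) (next b) v eq′
      ...   | v″ , eq″ = join σ (iter φ k (tail b)) t , c , v″ ,
        trans (img-suc k b) (trans (cong (iter φ k) eq) eq″) , gc ,
        All-join σ (bounded-iter k (tail-bounded b)) bt ,
        subst (_≤ cost (suc k) b) (sym (length-join σ (iter φ k (tail b)) t))
          (+-mono-≤ (bounded-iter-length k (tail-bounded b)) le)

      module _ (empty : CycleEdgesEmpty (Edge σ)) where

        tail-empty : ∀ {b} k → n ≤ k → Growing φ b → tail (fold b next k) ≡ []
        tail-empty {b} k n≤k g with eventually-periodic next b k n≤k
        ... | p , eq = empty _ _ _ (edge (orbit-growing k g))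
          (subst (Star (Unlabel (Edge σ)) (next (fold b next k))) eq
            (orbit-path p (next-growing (orbit-growing k g))))

        cost-stable : ∀ k {b} → Growing φ b → cost (k + n) b ≡ cost n b
        cost-stable zero    g = refl
        cost-stable (suc k) {b} g = begin
          cost (suc (k + n)) b                                             ≡⟨ cost-suc (k + n) b ⟩
          cost (k + n) b + length (tail (fold b next (k + n))) * maxBounded
            ≡⟨ cong (λ z → cost (k + n) b + length z * maxBounded) (tail-empty (k + n) (m≤n+m n k) g) ⟩
          cost (k + n) b + 0                                               ≡⟨ +-identityʳ _ ⟩
          cost (k + n) b                                                   ≡⟨ cost-stable k g ⟩
          cost n b                                                         ∎
          where open ≡-Reasoning

        end-bound : ∃ λ C → ∀ k {b} → Growing φ b → ∃ λ t → ∃₂ λ c v → img k b ≡ place σ t c v ×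
          Growing φ c × length t ≤ C
        end-bound with sup (cost n)
        ... | C , h = C , λ k {b} g → let t , c , v , eq , gc , _ , le = img-end k g in
          t , c , v , eq , gc ,
          -- Passing through `k + n` avoids comparing `k` with `n`: the cost is monotone in the
          -- number of steps and constant from `n` on.
          ≤-trans le (≤-trans (cost-+ k n b) (≤-trans (≤-reflexive (cost-stable k g)) (h b)))

    -- Uniform bound on factors made of bounded letters.

    module BoundedRuns (emptyL : CycleEdgesEmpty (Edge left)) (emptyR : CycleEdgesEmpty (Edge right)) where

      endL = Tails.end-bound left emptyL
      endR = Tails.end-bound right emptyR
      maxImage = sup (length ∘ φ)

      CL CR W : ℕ
      CL = proj₁ endL
      CR = proj₁ endR
      W  = proj₁ maxImage

      -- Each leading bounded letter of `y` contributes at most `maxBounded`; the first growing one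
      -- stops the run within its left tail, of length at most `CL`.
      prefix-bound : ∀ k y {w q} → iter φ k y ≡ w ++ q → All (Bounded φ) w →
        length w ≤ length y * maxBounded + CL
      prefix-bound k [] {w} {q} eq bw = ≤-trans
        (length-Factor ([] , q , trans (sym (iter-[] k)) eq)) z≤n
      prefix-bound k (a ∷ y) {w} {q} eq bw with growing? a
      ... | yes g with proj₂ endL k g
      ...   | t , c , v , eq′ , gc , le = ≤-trans
        (before-first t w (begin
          t ++ c ∷ v ++ iter φ k y    ≡⟨ ++-assoc t (c ∷ v) _ ⟨
          (t ++ c ∷ v) ++ iter φ k y  ≡⟨ cong (_++ iter φ k y) eq′ ⟨
          img k a ++ iter φ k y       ≡⟨ iter-++ k (a ∷ []) ⟨
          iter φ k (a ∷ y)            ≡⟨ eq ⟩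
          w ++ q                      ∎) (λ bc → bc gc) bw)
        (≤-trans le (m≤n+m CL _))
        where open ≡-Reasoning
      prefix-bound k (a ∷ y) {w} {q} eq bw | no ba with ++-split (img k a) w (trans (sym (iter-++ k (a ∷ []))) eq)
      ... | inj₁ (r , refl , e) = begin
        length (img k a ++ r)                         ≡⟨ length-++ (img k a) ⟩
        length (img k a) + length r
          ≤⟨ +-mono-≤ (bounded-img ba k) (prefix-bound k y e (++⁻ʳ (img k a) bw)) ⟩
        maxBounded + (length y * maxBounded + CL)     ≡⟨ +-assoc maxBounded _ CL ⟨
        maxBounded + length y * maxBounded + CL       ∎
        where open ≤-Reasoning
      ... | inj₂ (r , e , _) = ≤-trans (length-Factor ([] , r , e))
        (≤-trans (bounded-img ba k) (≤-trans (m≤m+n _ _) (m≤m+n _ CL)))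

      suffix-bound : ∀ k a {p r} → img k a ≡ p ++ r → All (Bounded φ) r → length r ≤ maxBounded + CR
      suffix-bound k a {p} {r} eq br with growing? a
      ... | no ba = ≤-trans (length-Factor (p , [] , trans eq (cong (p ++_) (sym (++-identityʳ r)))))
        (≤-trans (bounded-img ba k) (m≤m+n _ CR))
      ... | yes g with proj₂ endR k g
      ...   | t , c , v , eq′ , gc , le =
        ≤-trans (after-last v p (trans (sym eq′) eq) (λ bc → bc gc) br) (≤-trans le (m≤n+m CR _))

      -- The sum bounds a run that straddles a cut inside `φᵏ(φ(a))`: a suffix of the image of one
      -- letter, then a prefix of the image of at most `W` letters. The extra 1 covers the single
      -- letter at `k = 0`.
      B : ℕ
      B = 1 + (maxBounded + CR + (W * maxBounded + CL))

      -- A run in `φᵏ(φ(a))` lies inside the image of one letter, where `k` has dropped, or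
      -- straddles a cut. Scanning the letters of `φ(a)`, the run is cut only at the first boundary
      -- it crosses and both pieces are bounded outright there, so nothing accumulates over `k`.
      run-bound : ∀ k a {w} → Factor w (img k a) → All (Bounded φ) w → length w ≤ B
      run-bound-word : ∀ k y → length y ≤ W → ∀ {w} → Factor w (iter φ k y) →
        All (Bounded φ) w → length w ≤ B

      run-bound zero    a f bw = ≤-trans (length-Factor f) (s≤s z≤n)
      run-bound (suc k) a f bw = run-bound-word k (φ a) (proj₂ maxImage a)
        (subst (Factor _) (img-suc k a) f) bw

      run-bound-word k [] le {w} f bw =
        ≤-trans (length-Factor (subst (Factor w) (iter-[] k) f)) z≤n
      run-bound-word k (a ∷ y) le {w} (p , q , eq) bw
        with ++-split (img k a) p (trans (sym (iter-++ k (a ∷ []))) eq)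
      ... | inj₁ (r , refl , e) = run-bound-word k y (≤-trans (n≤1+n _) le) (r , q , e) bw
      ... | inj₂ (r , e , e₂) with ++-split w r e₂
      ...   | inj₁ (r′ , refl , _) = run-bound k a (p , r′ , e) bw
      ...   | inj₂ (r′ , refl , e₃) = begin
        length (r ++ r′)                                         ≡⟨ length-++ r ⟩
        length r + length r′
          ≤⟨ +-mono-≤ (suffix-bound k a e (++⁻ˡ r bw)) (prefix-bound k y e₃ (++⁻ʳ r bw)) ⟩
        maxBounded + CR + (length y * maxBounded + CL)
          ≤⟨ +-monoʳ-≤ (maxBounded + CR) (+-monoˡ-≤ CL (*-monoˡ-≤ maxBounded (≤-trans (n≤1+n _) le))) ⟩
        maxBounded + CR + (W * maxBounded + CL)                  ≤⟨ n≤1+n _ ⟩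
        B                                                        ∎
        where open ≤-Reasoning

    -- Locating an occurrence in a window of a word cut into blocks.

    module Window {B : ℕ} (K : ℕ) {u : Word} (hit : ∀ {b} → Growing φ b → Factor u (img K b)) where

      maxImg : ∃ λ M → ∀ a → length (img K a) ≤ M
      maxImg = sup (λ a → length (img K a))

      -- `M` bounds the blocks and is made positive, so that more blocks allow strictly more length.
      -- The window has room for the block in which it starts, `B` bounded blocks and one growing
      -- block.
      M l : ℕ
      M = suc (proj₁ maxImg)
      l = (2 + B) * M

      img≤M : ∀ a → length (img K a) ≤ M
      img≤M a = ≤-trans (proj₂ maxImg a) (n≤1+n _)

      -- Blocks ending at or before `j` are dropped. The block of `a` that extends beyond `j` is
      -- skipped even if `a` grows, since its copy of `u` may start too early; the next growing
      -- letter comes after at most `B` others.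
      find-window : ∀ y j → (∀ {w} → Factor w y → All (Bounded φ) w → length w ≤ B) →
        j + l ≤ length (iter φ K y) →
        ∃₂ λ p q → iter φ K y ≡ p ++ u ++ q × j ≤ length p × length p + length u ≤ j + l
      find-window [] j runs le rewrite iter-[] K =
        contradiction (≤-trans (m≤n+m l j) le) λ ()
      find-window (a ∷ y) j runs le with length (img K a) ≤? j
      ... | yes L≤j = shift (find-window y (j ∸ L) (λ { (p , q , eq) → runs (a ∷ p , q , cong (a ∷_) eq) })
          (+-cancelˡ-≤ L _ _ (begin
            L + (j ∸ L + l)                    ≡⟨ +-assoc L (j ∸ L) l ⟨
            L + (j ∸ L) + l                    ≡⟨ cong (_+ l) (m+[n∸m]≡n L≤j) ⟩
            j + l                              ≤⟨ le ⟩
            length (iter φ K (a ∷ y))          ≡⟨ cong length (iter-++ K (a ∷ [])) ⟩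
            length (img K a ++ iter φ K y)     ≡⟨ length-++ (img K a) ⟩
            L + length (iter φ K y)            ∎)))
        where
        open ≤-Reasoning
        L = length (img K a)
        shift : (∃₂ λ p q → iter φ K y ≡ p ++ u ++ q × j ∸ L ≤ length p × length p + length u ≤ j ∸ L + l) →
          ∃₂ λ p q → iter φ K (a ∷ y) ≡ p ++ u ++ q × j ≤ length p × length p + length u ≤ j + l
        shift (p , q , eq , lo , hi) = img K a ++ p , q ,
          trans (iter-++ K (a ∷ [])) (trans (cong (img K a ++_) eq) (sym (++-assoc (img K a) p _))) ,
          (begin
            j                       ≡⟨ m+[n∸m]≡n L≤j ⟨
            L + (j ∸ L)             ≤⟨ +-monoʳ-≤ L lo ⟩
            L + length p            ≡⟨ length-++ (img K a) ⟨
            length (img K a ++ p)   ∎) ,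
          (begin
            length (img K a ++ p) + length u  ≡⟨ cong (_+ length u) (length-++ (img K a)) ⟩
            L + length p + length u           ≡⟨ +-assoc L _ _ ⟩
            L + (length p + length u)         ≤⟨ +-monoʳ-≤ L hi ⟩
            L + (j ∸ L + l)                   ≡⟨ +-assoc L (j ∸ L) l ⟨
            L + (j ∸ L) + l                   ≡⟨ cong (_+ l) (m+[n∸m]≡n L≤j) ⟩
            j + l                             ∎)
      ... | no L≰j with nearest growing? left y
      -- With no growing letter left, `y` is itself a run, and at most `1 + B` blocks would have to
      -- fill the window.
      ...   | inj₂ by = contradiction (begin
          (2 + B) * M                 ≤⟨ m≤n+m l j ⟩
          j + l                       ≤⟨ le ⟩
          length (iter φ K (a ∷ y))   ≤⟨ length-iter-≤ K (a ∷ y) (λ _ → img≤M _) ⟩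
          suc (length y) * M          ≤⟨ *-monoˡ-≤ M (s≤s (runs (a ∷ [] , [] , cong (a ∷_) (sym (++-identityʳ y))) by)) ⟩
          (1 + B) * M                 ∎) (<⇒≱ (*-monoˡ-< M (n<1+n (1 + B))))
        where open ≤-Reasoning
      ...   | inj₁ (t , c , v , refl , gc , bt) with hit gc
      ...     | p , q , eq = P , q ++ iter φ K v , eqP , ≤-trans (<⇒≤ (≰⇒> L≰j)) lower , ≤-trans upper (m≤n+m l j)
        where
        P = iter φ K (a ∷ t) ++ p
        eqP : iter φ K (a ∷ t ++ c ∷ v) ≡ P ++ u ++ q ++ iter φ K v
        eqP = begin
          iter φ K ((a ∷ t) ++ c ∷ v)                        ≡⟨ iter-++ K (a ∷ t) ⟩
          iter φ K (a ∷ t) ++ iter φ K (c ∷ v)               ≡⟨ cong (iter φ K (a ∷ t) ++_) (iter-++ K (c ∷ [])) ⟩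
          iter φ K (a ∷ t) ++ img K c ++ iter φ K v
            ≡⟨ cong (λ z → iter φ K (a ∷ t) ++ z ++ iter φ K v) eq ⟩
          iter φ K (a ∷ t) ++ (p ++ u ++ q) ++ iter φ K v    ≡⟨ ++-regroup (iter φ K (a ∷ t)) p u ⟩
          P ++ u ++ q ++ iter φ K v                          ∎
          where open ≡-Reasoning
        lower : length (img K a) ≤ length P
        lower = length-Factor {u = img K a} ([] , iter φ K t ++ p ,
          trans (cong (_++ p) (iter-++ K (a ∷ []))) (++-assoc (img K a) (iter φ K t) p))
        upper : length P + length u ≤ l
        upper = begin
          length P + length u                          ≡⟨ cong (_+ length u) (length-++ (iter φ K (a ∷ t))) ⟩
          length (iter φ K (a ∷ t)) + length p + length u
            ≡⟨ +-assoc (length (iter φ K (a ∷ t))) _ _ ⟩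
          length (iter φ K (a ∷ t)) + (length p + length u)
            ≤⟨ +-mono-≤ (length-iter-≤ K (a ∷ t) (λ _ → img≤M _)) pu≤M ⟩
          suc (length t) * M + M
            ≤⟨ +-monoˡ-≤ M (*-monoˡ-≤ M (s≤s (runs (a ∷ [] , c ∷ v , refl) bt))) ⟩
          (1 + B) * M + M                              ≡⟨ +-comm ((1 + B) * M) M ⟩
          l                                            ∎
          where
          open ≤-Reasoning
          pu≤M : length p + length u ≤ M
          pu≤M = begin
            length p + length u    ≡⟨ length-++ p ⟨
            length (p ++ u)        ≤⟨ length-Factor ([] , q , trans eq (sym (++-assoc p u q))) ⟩
            length (img K c)       ≤⟨ img≤M c ⟩
            M                      ∎

    -- Finite prefixes of the fixed point.

    module FixedPoint {s : Fin n} {u : Word} (φs : φ s ≡ s ∷ u) (u≢[] : u ≢ []) where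

      x : ℕ → Fin n
      x = fixpt φ s

      img-suc-s : ∀ k → img (suc k) s ≡ img k s ++ iter φ k u
      img-suc-s k = trans (img-suc k s) (trans (cong (iter φ k) φs) (iter-++ k (s ∷ [])))

      img-s-length : ∀ k → suc k ≤ length (img k s)
      img-s-length zero    = ≤-refl
      img-s-length (suc k) = begin
        2 + k                                 ≡⟨ +-comm 1 (suc k) ⟩
        suc k + 1                             ≤⟨ +-mono-≤ (img-s-length k) (≤-trans (≢[]⇒1≤length u≢[]) (iter-length k u)) ⟩
        length (img k s) + length (iter φ k u)  ≡⟨ length-++ (img k s) ⟨
        length (img k s ++ iter φ k u)        ≡⟨ cong length (img-suc-s k) ⟨
        length (img (suc k) s)                ∎
        where open ≤-Reasoning

      s-growing : Growing φ s
      s-growing = growing-from λ N → N , ≤-trans (n≤1+n N) (img-s-length N)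

      s-persists : ∀ k → s ∈ img k s
      s-persists zero    = here refl
      s-persists (suc k) = subst (s ∈_) (sym (img-suc-s k)) (∈-++⁺ˡ (s-persists k))

      img-s-prefix : ∀ k m → ∃ λ v → img (m + k) s ≡ img k s ++ v
      img-s-prefix k zero    = [] , sym (++-identityʳ _)
      img-s-prefix k (suc m) with img-s-prefix k m
      ... | v , eq = v ++ iter φ (m + k) u ,
        trans (img-suc-s (m + k)) (trans (cong (_++ iter φ (m + k) u) eq) (++-assoc (img k s) v _))

      -- The letter `x i` is read off `φⁱ⁺¹(s)`; that word and `φᵏ(s)` are prefixes of one longer
      -- iterate, so they agree at `i`.
      x-nth : ∀ k i → i < length (img k s) → x i ≡ nth s (img k s) i
      x-nth k i i< with img-s-prefix k (suc i) | img-s-prefix (suc i) k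
      ... | v , eq | v′ , eq′ = begin
        nth s (img (suc i) s) i        ≡⟨ nth-++ˡ (img (suc i) s) (≤-trans (n≤1+n _) (img-s-length (suc i))) ⟨
        nth s (img (suc i) s ++ v′) i  ≡⟨ cong (λ z → nth s z i) eq′ ⟨
        nth s (img (k + suc i) s) i    ≡⟨ cong (λ z → nth s (img z s) i) (+-comm k (suc i)) ⟩
        nth s (img (suc i + k) s) i    ≡⟨ cong (λ z → nth s z i) eq ⟩
        nth s (img k s ++ v) i         ≡⟨ nth-++ˡ (img k s) i< ⟩
        nth s (img k s) i              ∎
        where open ≡-Reasoning

      occurs-img : ∀ k → OccursAt x (img k s) 0
      occurs-img k = occurs-pointwise x (img k s) λ i i< →
        trans (cong x (+-identityʳ i)) (x-nth k i i<)

      occurs-at : ∀ {w} k p q → img k s ≡ p ++ w ++ q → OccursAt x w (length p)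
      occurs-at {w} k p q eq = subst (OccursAt x w) (+-identityʳ (length p))
        (occurs-++⁻ˡ x w (occurs-++⁻ʳ x p (subst (λ z → OccursAt x z 0) eq (occurs-img k))))

      IsFactor⇒Factor : ∀ {w} → IsFactor w x → ∃ λ k → Factor w (img k s)
      -- The `k`-th iterate has more than `k` letters, so this exponent reaches the end of the
      -- occurrence.
      IsFactor⇒Factor {w} (i , o) = i + length w ,
        occurs⇒Factor x w _ o (occurs-img (i + length w))
          (≤-trans (n≤1+n _) (img-s-length (i + length w)))

      letter : ∀ {a} → (∃ λ i → x i ≡ a) → ∃ λ k → a ∈ img k s
      letter (i , eq) with IsFactor⇒Factor (i , eq , tt)
      ... | k , f = k , ∈-Factor (here refl) f

      -- Almost periodicity implies both graph conditions.

      module Necessity (ap : AlmostPeriodic x) (full : ∀ a → ∃ λ i → x i ≡ a) where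

        -- `l` is the window length for the one-letter word `c`; the window that starts where `w`
        -- occurs in `x` fits inside `w`.
        long-factor : ∀ c → ∃ λ l → ∀ k w → Factor w (img k s) → l ≤ length w → c ∈ w
        long-factor c with full c
        ... | i , eq with ap (c ∷ []) (i , eq , tt)
        ...   | l , h = l , λ { k w (p , q , eq′) l≤ →
          let r , lo , hi , (xr , _) = h (length p) in
          subst (_∈ w) xr (occurs-∈ x w (occurs-at k p q eq′) lo
            (≤-trans (≤-reflexive (+-comm 1 r)) (≤-trans hi (+-monoʳ-≤ (length p) l≤)))) }

        img-Factor : ∀ b m → ∃ λ k → Factor (img m b) (img k s)
        img-Factor b m with letter (full b)
        ... | k , b∈ = m + k , subst (Factor _) (sym (iter-+ m k _)) (iter-Factor m (∈⇒Factor b∈))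

        -- Every intermediate letter has the growing letter `c` in one of its images, so it grows
        -- too and the path stays in `I`.
        ∈-img⇒path : ∀ m {b c} → c ∈ img m b → Growing φ c → Star (GIEdge φ) b c
        ∈-img⇒path zero    (here refl) g = ε
        ∈-img⇒path (suc m) c∈ g with ∈-img-suc⁻ m c∈
        ... | e , e∈ , c∈e = (growing-pred e∈ ge , ge , e∈) ◅ ∈-img⇒path m c∈e g
          where ge = growing-back m c∈e g

        strongly-connected : StronglyConnectedOnI φ
        strongly-connected b c gb gc with long-factor c
        ... | l , h with gb l
        ...   | m , long with img-Factor b m
        ...     | k , f = ∈-img⇒path m (h k _ f (long m ≤-refl)) gc

        module _ (σ : Side) where

          path-label : ∀ {b c} → Star (Unlabel (Edge σ)) b c → ∃ λ m → ∃₂ λ t v →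
            img m b ≡ place σ t c v × All (Bounded φ) t
          path-label {b} ε = 0 , [] , [] , place-single σ b , []
          path-label {b} ((w , _ , _ , bw , v , eq) ◅ path) with path-label path
          ... | m , t , _ , eq′ , bt with iter-place m σ w _ v eq′
          ...   | v″ , eq″ = suc m , join σ (iter φ m w) t , v″ ,
            trans (img-suc m b) (trans (cong (iter φ m) eq) eq″) , All-join σ (bounded-iter m bw) bt

          -- Each round adds an image of `T` at the end `σ`, non-empty because `φ` is non-erasing.
          pump : ∀ {b P T V} → img P b ≡ place σ T b V → All (Bounded φ) T → 1 ≤ length T →
            ∀ k → ∃ λ m → ∃₂ λ t v → img m b ≡ place σ t b v × All (Bounded φ) t × k ≤ length t
          pump {b} eq bT 1≤ zero = 0 , [] , [] , place-single σ b , [] , z≤n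
          pump {b} {P} {T} {V} eq bT 1≤ (suc k) with pump {b} {P} eq bT 1≤ k
          ... | m , t , _ , eq′ , bt , k≤ with iter-place m σ T b V eq′
          ...   | v″ , eq″ = m + P , join σ (iter φ m T) t , v″ ,
            trans (iter-+ m P _) (trans (cong (iter φ m) eq) eq″) , All-join σ (bounded-iter m bT) bt ,
            subst (suc k ≤_) (sym (length-join σ (iter φ m T) t))
              (+-mono-≤ (≤-trans 1≤ (iter-length m T)) k≤)

          cycle-edges-empty : CycleEdgesEmpty (Edge σ)
          cycle-edges-empty b c [] _ _ = refl
          cycle-edges-empty b c w@(_ ∷ _) (_ , _ , bw , v , eq) cycle with path-label cycle
          ... | m , t , _ , eq′ , bt with iter-place m σ w c v eq′ | long-factor s
          ...   | v″ , eq″ | l , h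
            -- The offending edge followed by its return path: the tail in front of the end `σ`
            -- contains `φᵐ(w)`, hence is non-empty.
            with pump {b} {suc m} (trans (img-suc m b) (trans (cong (iter φ m) eq) eq″))
                   (All-join σ (bounded-iter m bw) bt)
                   (subst (1 ≤_) (sym (length-join σ (iter φ m w) t))
                     (≤-trans (≤-trans (s≤s z≤n) (iter-length m w)) (m≤m+n _ _)))
                   l
          ...     | r , T , V , eqT , bT , l≤ with img-Factor b r
          ...       | k , f = contradiction s-growing (All.lookup bT (h k T
            (Factor-trans (subst (Factor T) (sym eqT) (place-Factor σ T b V)) f) l≤))

      -- The graph conditions imply almost periodicity.

      module Sufficiency (sc : StronglyConnectedOnI φ)
        (emptyL : CycleEdgesEmpty (Edge left)) (emptyR : CycleEdgesEmpty (Edge right)) where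

        open BoundedRuns emptyL emptyR using (B; run-bound)

        path⇒∈-img : ∀ {b c} → Star (GIEdge φ) b c → ∃ λ m → c ∈ img m b
        path⇒∈-img ε = 0 , here refl
        path⇒∈-img ((_ , _ , e∈) ◅ path) with path⇒∈-img path
        ... | m , c∈ = suc m , ∈-img-suc m e∈ c∈

        reach-s : ∀ b → ∃ λ m → Growing φ b → s ∈ img m b
        reach-s b with growing? b
        -- A dummy exponent at bounded letters, so that `sup` can range over the whole alphabet.
        ... | no ¬g = 0 , λ g → contradiction g ¬g
        ... | yes g with path⇒∈-img (sc b s g s-growing)
        ...   | m , s∈ = m , λ _ → s∈

        -- Since `φ(s)` begins with `s`, the letter `s` persists once it has appeared, and all
        -- exponents can be raised to their maximum.
        reach-s-uniformly : ∃ λ m → ∀ {b} → Growing φ b → s ∈ img m b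
        reach-s-uniformly with sup (proj₁ ∘ reach-s)
        ... | m , h = m , λ {b} g → let r = proj₁ (reach-s b) in
          subst (s ∈_) (trans (sym (iter-+ (m ∸ r) r _)) (cong (λ z → img z b) (m∸n+n≡m (h b))))
            (∈-iter (m ∸ r) (proj₂ (reach-s b) g) (s-persists (m ∸ r)))

        almost-periodic : AlmostPeriodic x
        almost-periodic w fw with IsFactor⇒Factor fw | reach-s-uniformly
        ... | k , f | m , s∈ = l , occurrence
          where
          -- The word `φᵐ(b)` contains `s`, and `φᵏ(s)` contains `w`.
          hit : ∀ {b} → Growing φ b → Factor w (img (k + m) b)
          hit g = Factor-trans f (subst (Factor _) (sym (iter-+ k m _)) (iter-Factor k (∈⇒Factor (s∈ g))))
          open Window {B} (k + m) hit
          occurrence : ∀ j → ∃ λ i → (j ≤ i) × (i + length w ≤ j + l) × OccursAt x w i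
          -- The iterate `φʲ⁺ˡ(s)` has more than `j + l` letters and its image is no shorter, so the
          -- window fits.
          occurrence j with find-window (img (j + l) s) j (λ fr → run-bound (j + l) s fr)
            (≤-trans (≤-trans (n≤1+n _) (img-s-length (j + l))) (iter-length (k + m) _))
          ... | p , q , eq , lo , hi = length p , lo , hi ,
            occurs-at (k + m + (j + l)) p q (trans (iter-+ (k + m) (j + l) _) eq)

theorem1 : (n : ℕ) (φ : Morphism n) (s : Fin n) →
    NonErasing φ → Prolongable φ s →
    (∀ a → ∃ λ i → fixpt φ s i ≡ a) →
    AlmostPeriodic (fixpt φ s) ⇔
    (StronglyConnectedOnI φ × CycleEdgesEmpty (LEdge φ) × CycleEdgesEmpty (REdge φ))
theorem1 n φ s ne (u , φs , u-alive) full = mk⇔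
  (λ ap → let open Necessity ap full in
    strongly-connected , cycle-edges-empty left , cycle-edges-empty right)
  (λ (sc , emptyL , emptyR) → Sufficiency.almost-periodic sc emptyL emptyR)
  where
  open Morphisms φ
  open FixedPoint ne φs (u-alive 0)
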